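{- For all processes $s,t$ of a PTS over $A_\tau$, the weak trace metric equals the $\mathcal{L}^{\mathrm{w}}$-distance: $\mathbf{d}^{\mathrm{w}}(s,t)=D_{\mathcal{L}^{\mathrm{w}}}(s,t)$.
   Context: PTS $(\mathcal{S},A_\tau,\to)$ with $A_\tau=A\cup\{\tau\}$, finitely supported distributions; processes image-finite and finite. Computations $c=s_0\xrightarrow{a_1}\cdots\xrightarrow{a_n}s_n$ via transitions $s_{i-1}\xrightarrow{a_i}\pi_i$, $s_i\in\mathrm{supp}(\pi_i)$; $\Pr(c)=\prod\pi_i(s_i)$; $|c|=n$; $\mathrm{tr}(c)=a_1\cdots a_n\in A_\tau^\star$; maximal = not a proper prefix of another computation from the same process; $\mathcal{C}_{\max}(z)$, $\mathcal{C}_{\max}(z,\alpha)$ those with trace $\alpha$. A resolution of $s$ is a PTS $\mathcal{Z}=(Z,A_\tau,\to_{\mathcal{Z}})$ with $\mathrm{corr}\colon Z\to\mathcal{S}$ and initial state $z_s$, $\mathrm{corr}(z_s)=s$, such that $z_s$ is in no target support, every other state is in the support of a target of a transition from a different state, every $z\xrightarrow{a}_{\mathcal{Z}}\pi$ is matched by $\mathrm{corr}(z)\xrightarrow{a}\pi'$ with $\pi(z')=\pi'(\mathrm{corr}(z'))$, and each state has at most one outgoing transition; $\mathrm{res}(s)$ the set of resolutions. $TD_{\mathcal{Z}}(\alpha)=\Pr(\mathcal{C}_{\max}(z,\alpha))$, $\alpha\in A_\tau^\star$. Words $\alpha\equiv\beta$ iff they coincide after deleting all $\tau$'s. Kantorovich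 lifting $\mathcal{K}(d)(\pi,\pi')=\min_\omega\sum\omega(x,y)d(x,y)$ over couplings; Hausdorff lifting $\mathcal{H}(\hat d)(X,Y)=\max\{\sup_{x\in X}\inf_{y\in Y}\hat d(x,y),\sup_{y\in Y}\inf_{x\in X}\hat d(y,x)\}$ ($\inf\emptyset=1$, $\sup\emptyset=0$). $d_{\mathrm{w}}(\alpha,\beta)=0$ if $\alpha\equiv\beta$ else $1$; $D_{\mathrm{w}}(\mathcal{Z}_1,\mathcal{Z}_2)=\mathcal{K}(d_{\mathrm{w}})(TD_{\mathcal{Z}_1},TD_{\mathcal{Z}_2})$; $\mathbf{d}^{\mathrm{w}}(s,t)=\mathcal{H}(D_{\mathrm{w}})(\mathrm{res}(s),\mathrm{res}(t))$. Logic $\mathcal{L}^{\mathrm{w}}$: trace formulae $\Phi::=\top\mid\langle a\rangle\Phi$ with $a\in A_\tau$ (each is $\Phi_\alpha$ for a unique $\alpha$, $\Phi_\varepsilon=\top$, $\Phi_{a\alpha}=\langle a\rangle\Phi_\alpha$), $\mathrm{depth}(\Phi_\alpha)=|\alpha|$; trace distribution formulae $\bigoplus_{i\in I}r_i\Phi_i$ ($I$ finite nonempty, $\Phi_i$ pairwise distinct, $r_i\in(0,1]$, $\sum r_i=1$), identified with distributions on trace formulae. $c\models\top$ always; $c\models\langle a\rangle\Phi$ iff $c=s\xrightarrow{a}c'$ with $c'\models\Phi$. $s\models\bigoplus_i r_i\Phi_i$ iff some $\mathcal{Z}\in\mathrm{res}(s)$ with initial state $z$ satisfies $\Pr(\{c\in\mathcal{C}_{\max}(z):c\models\Phi_i,|c|=\mathrm{depth}(\Phi_i)\})=r_i$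 for all $i$; $\mathcal{L}^{\mathrm{w}}(s)$ the set of formulae satisfied by $s$. $d^{\mathrm{w}}(\Phi_\alpha,\Phi_\beta)=0$ if $\alpha\equiv\beta$ else $1$; $D^{\mathrm{w}}=\mathcal{K}(d^{\mathrm{w}})$ on trace distribution formulae; $D_{\mathcal{L}^{\mathrm{w}}}(s,t)=\mathcal{H}(D^{\mathrm{w}})(\mathcal{L}^{\mathrm{w}}(s),\mathcal{L}^{\mathrm{w}}(t))$. -}

module Defs where

open import Level using (Level; Setω; 0ℓ; _⊔_) renaming (suc to lsuc)
open import Algebra.Bundles using (CommutativeRing)
open import Axiom.ExcludedMiddle using (ExcludedMiddle)
open import Data.Bool.Base using (if_then_else_)
open import Data.Empty.Polymorphic using (⊥)
open import Data.Fin.Base using (Fin)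
open import Data.List.Base using (List; []; _∷_; _++_; map; foldr; length; catMaybes)
open import Data.List.Membership.Propositional using (_∈_)
open import Data.List.Relation.Unary.All using (All)
open import Data.List.Relation.Unary.Any using (Any)
open import Data.List.Relation.Unary.Unique.Propositional using (Unique)
open import Data.Maybe.Base using (Maybe; nothing; maybe′)
open import Data.Nat.Base using (ℕ; zero; suc)
open import Data.Product.Base using (Σ; ∃; _×_; _,_; proj₁)
open import Data.Sum.Base using ([_,_]′)
open import Data.Unit.Polymorphic using (⊤)
open import Function.Base using (const; _∘_)
open import Function.Definitions using (Injective)
open import Relation.Binary.Core using (Rel)
open import Relation.Binary.Structures using (IsTotalOrder)
open import Relation.Binary.PropositionalEquality using (_≡_; _≢_)
open import Relation.Nullary using (¬_; yes; no; does)
open import Relation.Unary using (Pred; U)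

private
  variable
    i j p ℓ ℓ′ ℓ″ : Level
    I : Set i

-- Complete ordered fields, i.e. the real numbers up to isomorphism.
-- Completeness ranges over families indexed by types of every universe.

record Reals : Setω where
  field
    commutativeRing : CommutativeRing 0ℓ 0ℓ

  open CommutativeRing commutativeRing public
    renaming (Carrier to ℝ) hiding (zero)

  infix 4 _≤_ _<_

  field
    _≤_          : Rel ℝ 0ℓ
    isTotalOrder : IsTotalOrder _≈_ _≤_
    +-monoˡ-≤    : ∀ {x y} z → x ≤ y → x + z ≤ y + z
    *-nonNeg     : ∀ {x y} → 0# ≤ x → 0# ≤ y → 0# ≤ x * y
    0≉1          : ¬ 0# ≈ 1#
    inverse      : ∀ x → ¬ x ≈ 0# → ∃ λ y → x * y ≈ 1#

  _<_ : Rel ℝ 0ℓ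
  x < y = x ≤ y × ¬ x ≈ y

  UpperBound : {I : Set i} → (I → ℝ) → ℝ → Set i
  UpperBound f b = ∀ k → f k ≤ b

  IsSup : {I : Set i} → (I → ℝ) → ℝ → Set i
  IsSup f x = UpperBound f x × (∀ b → UpperBound f b → x ≤ b)

  field
    complete : {I : Set i} (f : I → ℝ) → I → ∃ (UpperBound f) → ∃ (IsSup f)

module TraceMetrics (em : ∀ {ℓ} → ExcludedMiddle ℓ) (reals : Reals) where

  open Reals reals
  open IsTotalOrder isTotalOrder using (total)

  -- Equal to 0# when the family is empty or unbounded.
  sup : {I : Set i} → (I → ℝ) → ℝ
  sup {I = I} f with em {P = I × ∃ (UpperBound f)}
  ... | yes (k , bounded) = proj₁ (complete f k bounded)
  ... | no _              = 0#

  inf : {I : Set i} → (I → ℝ) → ℝ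
  inf f = - sup (-_ ∘ f)

  -- Bounds in the lattice [0,1]: for values in [0,1] the adjoined element
  -- matters only when the family is empty, giving sup ∅ = 0 and inf ∅ = 1.
  ⋁ ⋀ : {I : Set i} → (I → ℝ) → ℝ
  ⋁ f = sup (maybe′ f 0#)
  ⋀ f = inf (maybe′ f 1#)

  max : ℝ → ℝ → ℝ
  max x y = [ const y , const x ]′ (total x y)

  -- The sum over P of a nonnegative function, as the supremum of its sums
  -- over finite subsets of P.
  ∑ : {I : Set i} → Pred I p → (I → ℝ) → ℝ
  ∑ {I = I} P f =
    sup {I = Σ (List I) λ xs → Unique xs × All P xs}
        (λ (xs , _) → foldr _+_ 0# (map f xs))

  record Dist (X : Set ℓ) : Set ℓ where
    field
      mass          : X → ℝ
      nonNeg        : ∀ x → 0# ≤ mass x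
      finiteSupport : ∃ λ xs → ∀ x → 0# < mass x → x ∈ xs
      total-mass    : ∑ U mass ≈ 1#

  open Dist public using (mass)

  _∈supp_ : {X : Set ℓ} → X → Dist X → Set
  x ∈supp π = 0# < mass π x

  _≐_ : {X : Set ℓ} → Dist X → Dist X → Set ℓ
  π ≐ π′ = ∀ x → mass π x ≈ mass π′ x

  record Coupling {X : Set ℓ} {Y : Set ℓ′} (μ : X → ℝ) (ν : Y → ℝ) : Set (ℓ ⊔ ℓ′) where
    field
      joint     : Dist (X × Y)
      marginal₁ : ∀ x → ∑ U (λ y → mass joint (x , y)) ≈ μ x
      marginal₂ : ∀ y → ∑ U (λ x → mass joint (x , y)) ≈ ν y

  open Coupling public using (joint)

  -- Only used at mass functions of finitely supported distributions, where
  -- the infimum is attained.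
  𝒦 : {X : Set ℓ} → (X → X → ℝ) → (X → ℝ) → (X → ℝ) → ℝ
  𝒦 {X = X} d μ ν = inf {I = Coupling μ ν} λ ω →
    ∑ {I = X × X} U (λ (x , y) → mass (joint ω) (x , y) * d x y)

  ℋ : {X : Set ℓ} → (X → X → ℝ) → Pred X ℓ′ → Pred X ℓ″ → ℝ
  ℋ d X Y = max (⋁ {I = ∃ X} λ (x , _) → ⋀ {I = ∃ Y} λ (y , _) → d x y)
                (⋁ {I = ∃ Y} λ (y , _) → ⋀ {I = ∃ X} λ (x , _) → d y x)

  -- The action set extended with the silent action.
  _∪τ : Set ℓ → Set ℓ
  A ∪τ = Maybe A

  pattern τ = nothing

  _≡τ_ : {A : Set ℓ} → Rel (List (A ∪τ)) ℓ
  α ≡τ β = catMaybes α ≡ catMaybes β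

  record PTS (A : Set ℓ) : Set (lsuc ℓ) where
    field
      State   : Set ℓ
      _─[_]→_ : State → A ∪τ → Dist State → Set ℓ

    ImageFinite : State → Set ℓ
    ImageFinite s =
      ∀ a → ∃ λ (πs : List (Dist State)) → ∀ π → s ─[ a ]→ π → Any (π ≐_) πs

    -- No infinite computation starts in s.
    Finite : State → Set ℓ
    Finite s = ¬ ∃ λ (f : ℕ → State) → f zero ≡ s ×
      (∀ n → ∃ λ a → ∃ λ π → (f n ─[ a ]→ π) × (f (suc n) ∈supp π))

    -- The steps (aᵢ , πᵢ , sᵢ) of a computation; the source s₀ is kept apart.
    Computation : Set ℓ
    Computation = List ((A ∪τ) × Dist State × State)

    IsComputation : State → Pred Computation ℓ
    IsComputation s []                 = ⊤
    IsComputation s ((a , π , s′) ∷ c) =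
      (s ─[ a ]→ π) × (s′ ∈supp π) × IsComputation s′ c

    𝒞max : State → Pred Computation ℓ
    𝒞max s c = IsComputation s c × (∀ e → IsComputation s (c ++ e) → e ≡ [])

    Pr : Computation → ℝ
    Pr []                 = 1#
    Pr ((_ , π , s′) ∷ c) = mass π s′ * Pr c

    tr : Computation → List (A ∪τ)
    tr = map proj₁

  record RootedPTS (A : Set ℓ) : Set (lsuc ℓ) where
    field
      pts  : PTS A
      root : PTS.State pts
    open PTS pts public

  TD : {A : Set ℓ} → RootedPTS A → List (A ∪τ) → ℝ
  TD 𝒵 α = ∑ (λ c → 𝒞max root c × tr c ≡ α) Pr
    where open RootedPTS 𝒵

  d-w : {A : Set ℓ} → List (A ∪τ) → List (A ∪τ) → ℝ
  d-w α β = if does (em {P = α ≡τ β}) then 0# else 1#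

  D-w : {A : Set ℓ} → RootedPTS A → RootedPTS A → ℝ
  D-w 𝒵₁ 𝒵₂ = 𝒦 d-w (TD 𝒵₁) (TD 𝒵₂)

  data TraceFormula (A : Set ℓ) : Set ℓ where
    tt    : TraceFormula A
    ⟨_⟩_ : A ∪τ → TraceFormula A → TraceFormula A

  module _ {A : Set ℓ} where

    depth : TraceFormula A → ℕ
    depth tt        = 0
    depth (⟨ _ ⟩ Φ) = suc (depth Φ)

    -- The unique α with Φ = Φ_α.
    word : TraceFormula A → List (A ∪τ)
    word tt        = []
    word (⟨ a ⟩ Φ) = a ∷ word Φ

    d-wL : TraceFormula A → TraceFormula A → ℝ
    d-wL Φ Ψ = if does (em {P = word Φ ≡τ word Ψ}) then 0# else 1#

  record TraceDistFormula (A : Set ℓ) : Set ℓ where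
    field
      {pred-size} : ℕ

    Index : Set
    Index = Fin (suc pred-size)

    field
      weight     : Index → ℝ
      formula    : Index → TraceFormula A
      distinct   : Injective _≡_ _≡_ formula
      weight-pos : ∀ k → 0# < weight k
      weight-≤1  : ∀ k → weight k ≤ 1#
      weight-sum : ∑ U weight ≈ 1#

    ⟦_⟧ : TraceFormula A → ℝ
    ⟦_⟧ Φ = ∑ (λ k → formula k ≡ Φ) weight

  D-wL : {A : Set ℓ} → TraceDistFormula A → TraceDistFormula A → ℝ
  D-wL Ψ₁ Ψ₂ = 𝒦 d-wL (⟦_⟧ Ψ₁) (⟦_⟧ Ψ₂)
    where open TraceDistFormula

  module _ {A : Set ℓ} (𝒵 : RootedPTS A) where
    open RootedPTS 𝒵

    _⊨ᶜ_ : Computation → TraceFormula A → Set ℓ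
    c                 ⊨ᶜ tt        = ⊤
    []                ⊨ᶜ (⟨ a ⟩ Φ) = ⊥
    ((b , _ , _) ∷ c) ⊨ᶜ (⟨ a ⟩ Φ) = b ≡ a × c ⊨ᶜ Φ

    Realises : TraceDistFormula A → Set
    Realises Ψ = ∀ k →
      ∑ (λ c → 𝒞max root c × c ⊨ᶜ formula k × length c ≡ depth (formula k)) Pr
        ≈ weight k
      where open TraceDistFormula Ψ

  module _ {A : Set ℓ} (P : PTS A) where
    private module P = PTS P

    record IsResolution (s : P.State) (𝒵 : RootedPTS A) : Set ℓ where
      open RootedPTS 𝒵
      field
        corr          : State → P.State
        corr-root     : corr root ≡ s
        root-initial  : ∀ {z a π} → z ─[ a ]→ π → ¬ root ∈supp π
        reached       : ∀ z → z ≢ root →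
                        ∃ λ z′ → ∃ λ a → ∃ λ π →
                          z′ ≢ z × (z′ ─[ a ]→ π) × (z ∈supp π)
        matched       : ∀ {z a π} → z ─[ a ]→ π →
                        ∃ λ π′ → (corr z P.─[ a ]→ π′) ×
                          (∀ z′ → mass π z′ ≈ mass π′ (corr z′))
        -- Targets are compared by _≡_, as computations are: otherwise two
        -- representations of one distribution would be counted twice in TD.
        deterministic : ∀ {z a b π ρ} → z ─[ a ]→ π → z ─[ b ]→ ρ →
                        a ≡ b × π ≡ ρ

    res : P.State → Pred (RootedPTS A) ℓ
    res = IsResolution

    _⊨_ : P.State → TraceDistFormula A → Set (lsuc ℓ)
    s ⊨ Ψ = ∃ λ 𝒵 → res s 𝒵 × Realises 𝒵 Ψ

    ℒ-w : P.State → Pred (TraceDistFormula A) (lsuc ℓ)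
    ℒ-w s Ψ = s ⊨ Ψ

    𝐝-w : P.State → P.State → ℝ
    𝐝-w s t = ℋ D-w (res s) (res t)

    D-ℒw : P.State → P.State → ℝ
    D-ℒw s t = ℋ D-wL (ℒ-w s) (ℒ-w t)

{-# OPTIONS --safe #-}
-- A resolution of a finite process has finitely many maximal computations,
-- with total probability 1; hence its trace distribution is finitely supported
-- and positive on its support, and so is (up to α ↦ Φ_α) a trace distribution
-- formula realised by the resolution. Conversely, if a resolution realises a
-- formula, the weights of the formula already exhaust the mass 1 of the trace
-- distribution, so the two agree everywhere. Agreement thus relates res(s) and
-- ℒ-w(s) totally in both directions, and the Kantorovich distances of related
-- pairs coincide, since couplings are transported along α ↦ Φ_α; so the
-- Hausdorff liftings coincide as well.
module Submission where

open import Defs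
open import Algebra.Bundles using (CommutativeRing)
open import Axiom.ExcludedMiddle using (ExcludedMiddle)
open import Data.Bool.Base using (if_then_else_)
open import Data.Fin.Base using (Fin; zero; suc)
open import Data.List.Base
  using (List; []; _∷_; [_]; _++_; map; foldr; length; lookup; filter; concatMap; allFin; deduplicate)
open import Data.List.Membership.Propositional using (_∈_; _∉_; find; lose)
open import Data.List.Membership.Propositional.Properties
open import Data.List.Properties using (∷-injectiveˡ; ∷-injectiveʳ; map-∘; map-tabulate; tabulate-lookup)
open import Data.List.Relation.Unary.All as All using (All; []; _∷_)
import Data.List.Relation.Unary.All.Properties as All
open import Data.List.Relation.Unary.AllPairs as AllPairs using ([]; _∷_)
import Data.List.Relation.Unary.AllPairs.Properties as AllPairs
open import Data.List.Relation.Unary.Any using (here; there)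
open import Data.List.Relation.Unary.Any.Properties using (++⁺ˡ; ++⁺ʳ; ++⁻)
open import Data.List.Relation.Unary.Unique.Propositional using (Unique)
import Data.List.Relation.Unary.Unique.Propositional.Properties as Unique
import Data.List.Relation.Unary.Unique.DecPropositional.Properties as UniqueDec
open import Data.Maybe.Base using (just; nothing; maybe′)
open import Data.Nat.Base using (ℕ; zero; suc)
open import Data.Nat.Properties using (suc-injective)
open import Data.Product.Base using (∃; _×_; _,_; proj₁; proj₂)
open import Data.Sum.Base using (inj₁; inj₂)
open import Function.Base using (_∘_; id)
open import Data.Product.Function.NonDependent.Propositional using (_×-↔_)
open import Function.Bundles using (_↔_; mk↔ₛ′; Inverse; Injection)
open import Function.Properties.Inverse using (↔-sym; ↔⇒↣)
open import Induction.WellFounded using (Acc; acc)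
open import Level using (Level; _⊔_)
open import Relation.Binary.Definitions using (DecidableEquality)
open import Relation.Binary.PropositionalEquality as ≡ using (_≡_; _≢_)
open import Relation.Binary.Structures using (IsTotalOrder)
open import Relation.Nullary using (¬_; yes; no; does; contradiction)
open import Relation.Nullary.Decidable using (decidable-stable)
open import Relation.Unary using (Pred; Decidable; U)
import Algebra.Properties.Ring as RingProperties
import Algebra.Properties.CommutativeSemigroup as CommutativeSemigroupProperties
import Relation.Binary.Reasoning.Setoid as SetoidReasoning

private
  variable
    i j p q r : Level
    I : Set i
    J : Set j

lookup-injective : ∀ {xs : List I} → Unique xs → ∀ k l → lookup xs k ≡ lookup xs l → k ≡ l
lookup-injective (_ ∷ _)    zero    zero    _  = ≡.refl
lookup-injective (x∉xs ∷ _) zero    (suc l) eq = contradiction eq (All.lookup x∉xs (∈-lookup l))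
lookup-injective (x∉xs ∷ _) (suc k) zero    eq = contradiction (≡.sym eq) (All.lookup x∉xs (∈-lookup k))
lookup-injective (_ ∷ uniq) (suc k) (suc l) eq = ≡.cong suc (lookup-injective uniq k l eq)

module Proof (em : ∀ {ℓ} → ExcludedMiddle ℓ) (reals : Reals) where

  open Reals reals
  open IsTotalOrder isTotalOrder using (total; antisym)
    renaming (refl to ≤-refl; reflexive to ≤-reflexive; trans to ≤-trans)
  open TraceMetrics em reals
  open RingProperties (CommutativeRing.ring commutativeRing)
    using (-‿distribˡ-*; -‿involutive)
  open CommutativeSemigroupProperties (CommutativeRing.+-commutativeSemigroup commutativeRing)
    using (interchange; x∙yz≈y∙xz)
  open SetoidReasoning setoid
  open Inverse using (to; from; strictlyInverseˡ)

  -- Excluded middle decides equality in every type; this is what lets `filter` and `deduplicate`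
  -- act on lists of states, words and computations.
  _≟_ : DecidableEquality I
  _ ≟ _ = em

  -- Ordered fields

  ≤-respˡ : ∀ {x y z} → x ≈ y → x ≤ z → y ≤ z
  ≤-respˡ x≈y x≤z = ≤-trans (≤-reflexive (sym x≈y)) x≤z

  ≤-respʳ : ∀ {x y z} → x ≈ y → z ≤ x → z ≤ y
  ≤-respʳ x≈y z≤x = ≤-trans z≤x (≤-reflexive x≈y)

  +-mono-≤ : ∀ {x y u v} → x ≤ y → u ≤ v → x + u ≤ y + v
  +-mono-≤ {x} {y} {u} {v} x≤y u≤v = ≤-trans (+-monoˡ-≤ u x≤y)
    (≤-respˡ (+-comm u y) (≤-respʳ (+-comm v y) (+-monoˡ-≤ y u≤v)))

  +-cancelʳ-≤ : ∀ {x y} z → x + z ≤ y + z → x ≤ y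
  +-cancelʳ-≤ {x} {y} z x+z≤y+z =
    ≤-respˡ (+-inverse x) (≤-respʳ (+-inverse y) (+-monoˡ-≤ (- z) x+z≤y+z))
    where
    +-inverse : ∀ w → (w + z) + - z ≈ w
    +-inverse w = trans (+-assoc w z (- z)) (trans (+-congˡ (-‿inverseʳ z)) (+-identityʳ w))

  0≤1 : 0# ≤ 1#
  0≤1 with total 0# 1#
  ... | inj₁ 0≤1 = 0≤1
  -- If 1 were at most 0, then `- 1#` would be nonnegative, and so would its square, which is 1.
  ... | inj₂ 1≤0 = ≤-respʳ -1*-1≈1 (*-nonNeg 0≤-1 0≤-1)
    where
    0≤-1 : 0# ≤ - 1#
    0≤-1 = ≤-respˡ (-‿inverseʳ 1#) (≤-respʳ (+-identityˡ (- 1#)) (+-monoˡ-≤ (- 1#) 1≤0))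

    -1*-1≈1 : - 1# * - 1# ≈ 1#
    -1*-1≈1 = begin
      - 1# * - 1#   ≈⟨ -‿distribˡ-* 1# (- 1#) ⟨
      - (1# * - 1#) ≈⟨ -‿cong (*-identityˡ (- 1#)) ⟩
      - - 1#        ≈⟨ -‿involutive 1# ⟩
      1#            ∎

  0<1 : 0# < 1#
  0<1 = 0≤1 , 0≉1

  *-pos : ∀ {x y} → 0# < x → 0# < y → 0# < x * y
  *-pos {x} {y} (0≤x , x≉0) (0≤y , y≉0) = *-nonNeg 0≤x 0≤y , λ 0≈xy →
    let y⁻¹ , y*y⁻¹≈1 = inverse y (y≉0 ∘ sym) in x≉0 (begin
      0#              ≈⟨ zeroˡ y⁻¹ ⟨
      0# * y⁻¹        ≈⟨ *-congʳ 0≈xy ⟩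
      (x * y) * y⁻¹   ≈⟨ *-assoc x y y⁻¹ ⟩
      x * (y * y⁻¹)   ≈⟨ *-congˡ y*y⁻¹≈1 ⟩
      x * 1#          ≈⟨ *-identityʳ x ⟩
      x               ∎)

  <-≤-trans : ∀ {x y z} → x < y → y ≤ z → x < z
  <-≤-trans (x≤y , x≉y) y≤z =
    ≤-trans x≤y y≤z , λ x≈z → x≉y (antisym x≤y (≤-respʳ (sym x≈z) y≤z))

  <-respʳ : ∀ {x y z} → y ≈ z → x < y → x < z
  <-respʳ y≈z x<y = <-≤-trans x<y (≤-reflexive y≈z)

  nonPos⇒0 : ∀ {x} → 0# ≤ x → ¬ 0# < x → x ≈ 0#
  nonPos⇒0 0≤x 0≮x = decidable-stable em λ x≉0 → 0≮x (0≤x , x≉0 ∘ sym)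

  max-cong : ∀ {x x′ y y′} → x ≈ x′ → y ≈ y′ → max x y ≈ max x′ y′
  max-cong {x} {x′} {y} {y′} x≈x′ y≈y′ with total x y | total x′ y′
  ... | inj₁ _   | inj₁ _     = y≈y′
  ... | inj₂ _   | inj₂ _     = x≈x′
  -- `total` need not respect `_≈_`, so equal arguments may be compared in opposite ways; then both
  -- inequalities hold and all four numbers agree.
  ... | inj₁ x≤y | inj₂ y′≤x′ =
    antisym (≤-respˡ (sym y≈y′) y′≤x′) (≤-respˡ x≈x′ x≤y)
  ... | inj₂ y≤x | inj₁ x′≤y′ =
    antisym (≤-respˡ (sym x≈x′) x′≤y′) (≤-respˡ y≈y′ y≤x)

  -- Suprema

  isSup-unique : {f : I → ℝ} → ∀ {x y} → IsSup f x → IsSup f y → x ≈ y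
  isSup-unique (ub-x , least-x) (ub-y , least-y) = antisym (least-x _ ub-y) (least-y _ ub-x)

  sup-isSup : (f : I → ℝ) → I → ∃ (UpperBound f) → IsSup f (sup f)
  sup-isSup {I = I} f k bounded with em {P = I × ∃ (UpperBound f)}
  ... | yes (k′ , bounded′) = proj₂ (complete f k′ bounded′)
  ... | no ¬p               = contradiction (k , bounded) ¬p

  -- Inclusion of ranges. Bounds depend only on the range, so no bijection of index types is needed,
  -- and the two types may lie in different universes.
  _⊑_ : (I → ℝ) → (J → ℝ) → Set _
  f ⊑ g = ∀ k → ∃ λ l → f k ≈ g l

  ⊑-upperBound : {f : I → ℝ} {g : J → ℝ} → f ⊑ g → ∀ {b} → UpperBound g b → UpperBound f b
  ⊑-upperBound f⊑g ub k = let l , fk≈gl = f⊑g k in ≤-respˡ (sym fk≈gl) (ub l)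

  -- Indices and upper bounds transfer both ways, so the case split in `sup` falls on the same side
  -- for both families, the default 0 included.
  sup-cong : {f : I → ℝ} {g : J → ℝ} → f ⊑ g → g ⊑ f → sup f ≈ sup g
  sup-cong {I = I} {J = J} {f} {g} f⊑g g⊑f
    with em {P = I × ∃ (UpperBound f)} | em {P = J × ∃ (UpperBound g)}
  ... | no _ | no _ = refl
  ... | yes (k , b , ub) | no ¬p =
    contradiction (proj₁ (f⊑g k) , b , ⊑-upperBound g⊑f ub) ¬p
  ... | no ¬p | yes (l , b , ub) =
    contradiction (proj₁ (g⊑f l) , b , ⊑-upperBound f⊑g ub) ¬p
  ... | yes (k , bounded-f) | yes (l , bounded-g) =
    let ub-f , least-f = proj₂ (complete f k bounded-f)
        ub-g , least-g = proj₂ (complete g l bounded-g)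
    in antisym (least-f _ (⊑-upperBound f⊑g ub-g)) (least-g _ (⊑-upperBound g⊑f ub-f))

  inf-cong : {f : I → ℝ} {g : J → ℝ} → f ⊑ g → g ⊑ f → inf f ≈ inf g
  inf-cong f⊑g g⊑f = -‿cong (sup-cong (neg f⊑g) (neg g⊑f))
    where
    neg : ∀ {i j} {I : Set i} {J : Set j} {f : I → ℝ} {g : J → ℝ} →
          f ⊑ g → (-_ ∘ f) ⊑ (-_ ∘ g)
    neg f⊑g k = let l , fk≈gl = f⊑g k in l , -‿cong fk≈gl

  ⊑-maybe : {f : I → ℝ} {g : J → ℝ} → ∀ e → f ⊑ g → maybe′ f e ⊑ maybe′ g e
  ⊑-maybe e f⊑g nothing  = nothing , refl
  ⊑-maybe e f⊑g (just k) = let l , fk≈gl = f⊑g k in just l , fk≈gl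

  ⋁-cong : {f : I → ℝ} {g : J → ℝ} → f ⊑ g → g ⊑ f → ⋁ f ≈ ⋁ g
  ⋁-cong f⊑g g⊑f = sup-cong (⊑-maybe 0# f⊑g) (⊑-maybe 0# g⊑f)

  ⋀-cong : {f : I → ℝ} {g : J → ℝ} → f ⊑ g → g ⊑ f → ⋀ f ≈ ⋀ g
  ⋀-cong f⊑g g⊑f = inf-cong (⊑-maybe 1# f⊑g) (⊑-maybe 1# g⊑f)

  -- Finite sums

  sum : List I → (I → ℝ) → ℝ
  sum xs f = foldr _+_ 0# (map f xs)

  sum-cong : ∀ (xs : List I) {f g} → (∀ {x} → x ∈ xs → f x ≈ g x) → sum xs f ≈ sum xs g
  sum-cong []       f≈g = refl
  sum-cong (x ∷ xs) f≈g = +-cong (f≈g (here ≡.refl)) (sum-cong xs (f≈g ∘ there))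

  sum-map : ∀ (h : I → J) xs {f} → sum (map h xs) f ≈ sum xs (f ∘ h)
  sum-map h xs = reflexive (≡.cong (foldr _+_ 0#) (≡.sym (map-∘ xs)))

  sum-++ : ∀ (xs {ys} : List I) {f} → sum (xs ++ ys) f ≈ sum xs f + sum ys f
  sum-++ []       = sym (+-identityˡ _)
  sum-++ (x ∷ xs) = trans (+-congˡ (sum-++ xs)) (sym (+-assoc _ _ _))

  sum-concatMap : ∀ (h : I → List J) xs {f} →
                  sum (concatMap h xs) f ≈ sum xs (λ x → sum (h x) f)
  sum-concatMap h []       = refl
  sum-concatMap h (x ∷ xs) = trans (sum-++ (h x)) (+-congˡ (sum-concatMap h xs))

  sum-*ˡ : ∀ r (xs : List I) {f} → sum xs (λ x → r * f x) ≈ r * sum xs f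
  sum-*ˡ r []       = sym (zeroʳ r)
  sum-*ˡ r (x ∷ xs) = trans (+-congˡ (sum-*ˡ r xs)) (sym (distribˡ r _ _))

  sum-0 : ∀ (xs : List I) → sum xs (λ _ → 0#) ≈ 0#
  sum-0 []       = refl
  sum-0 (x ∷ xs) = trans (+-identityˡ _) (sum-0 xs)

  sum-+ : ∀ (xs : List I) {f g} → sum xs (λ x → f x + g x) ≈ sum xs f + sum xs g
  sum-+ []       = sym (+-identityˡ 0#)
  sum-+ (x ∷ xs) = trans (+-congˡ (sum-+ xs)) (interchange _ _ _ _)

  sum-swap : ∀ (xs : List I) (ys : List J) {h : I → J → ℝ} →
             sum xs (λ x → sum ys (h x)) ≈ sum ys (λ y → sum xs (λ x → h x y))
  sum-swap []       ys = sym (sum-0 ys)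
  sum-swap (x ∷ xs) ys = trans (+-congˡ (sum-swap xs ys)) (sym (sum-+ ys))

  sum-filter : ∀ {P : Pred I p} (P? : Decidable P) xs {f} →
               sum (filter P? xs) f ≈ sum xs (λ x → if does (P? x) then f x else 0#)
  sum-filter P? [] = refl
  sum-filter P? (x ∷ xs) with P? x
  ... | yes _ = +-congˡ (sum-filter P? xs)
  ... | no _  = trans (sum-filter P? xs) (sym (+-identityˡ _))

  sum-nonNeg : ∀ (xs : List I) {f} → (∀ {x} → x ∈ xs → 0# ≤ f x) → 0# ≤ sum xs f
  sum-nonNeg []       f≥0 = ≤-refl
  sum-nonNeg (x ∷ xs) f≥0 =
    ≤-respˡ (+-identityˡ 0#) (+-mono-≤ (f≥0 (here ≡.refl)) (sum-nonNeg xs (f≥0 ∘ there)))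

  sum-mono-≤ : ∀ (xs : List I) {f g} → (∀ {x} → x ∈ xs → f x ≤ g x) → sum xs f ≤ sum xs g
  sum-mono-≤ []       f≤g = ≤-refl
  sum-mono-≤ (x ∷ xs) f≤g = +-mono-≤ (f≤g (here ≡.refl)) (sum-mono-≤ xs (f≤g ∘ there))

  -- A positive head of `xs` is cancelled against one occurrence in `ys`; as `xs` has no
  -- repetitions, its tail never needs that occurrence again. Zero terms are dropped, and what is
  -- left over in `ys` is nonnegative.
  sum-⊆ : ∀ {xs ys : List I} {f} → Unique xs →
          (∀ {x} → x ∈ xs → 0# ≤ f x) → (∀ {y} → y ∈ ys → 0# ≤ f y) →
          (∀ {x} → x ∈ xs → 0# < f x → x ∈ ys) → sum xs f ≤ sum ys f
  sum-⊆ {xs = []}     {ys} []             f≥0 g≥0 xs⊆ys = sum-nonNeg ys g≥0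
  sum-⊆ {xs = x ∷ xs} {ys} {f} (x∉xs ∷ uniq) f≥0 g≥0 xs⊆ys with em {P = 0# < f x}
  ... | no 0≮fx = ≤-respˡ (sym (trans (+-congʳ (nonPos⇒0 (f≥0 (here ≡.refl)) 0≮fx)) (+-identityˡ _)))
                    (sum-⊆ uniq (f≥0 ∘ there) g≥0 (xs⊆ys ∘ there))
  ... | yes 0<fx with as , bs , ≡.refl ← ∈-∃++ (xs⊆ys (here ≡.refl) 0<fx) =
    ≤-respʳ rearrange (+-mono-≤ ≤-refl (sum-⊆ uniq (f≥0 ∘ there) (g≥0 ∘ insert) xs⊆as++bs))
    where
    insert : ∀ {y} → y ∈ as ++ bs → y ∈ as ++ x ∷ bs
    insert y∈ with ++⁻ as y∈
    ... | inj₁ y∈as = ++⁺ˡ y∈as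
    ... | inj₂ y∈bs = ++⁺ʳ as (there y∈bs)

    xs⊆as++bs : ∀ {y} → y ∈ xs → 0# < f y → y ∈ as ++ bs
    xs⊆as++bs y∈xs 0<fy with ++⁻ as (xs⊆ys (there y∈xs) 0<fy)
    ... | inj₁ y∈as          = ++⁺ˡ y∈as
    ... | inj₂ (here ≡.refl) = contradiction ≡.refl (All.lookup x∉xs y∈xs)
    ... | inj₂ (there y∈bs)  = ++⁺ʳ as y∈bs

    rearrange : f x + sum (as ++ bs) f ≈ sum (as ++ x ∷ bs) f
    rearrange = begin
      f x + sum (as ++ bs) f        ≈⟨ +-congˡ (sum-++ as) ⟩
      f x + (sum as f + sum bs f)   ≈⟨ x∙yz≈y∙xz (f x) _ _ ⟩
      sum as f + sum (x ∷ bs) f     ≈⟨ sum-++ as ⟨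
      sum (as ++ x ∷ bs) f          ∎

  sum-indicator-∉ : ∀ (xs : List I) {y r} → y ∉ xs →
                    sum xs (λ x → if does (y ≟ x) then r else 0#) ≈ 0#
  sum-indicator-∉ []       y∉xs = refl
  sum-indicator-∉ (x ∷ xs) {y} y∉xs with y ≟ x
  ... | yes y≡x = contradiction (here y≡x) y∉xs
  ... | no _    = trans (+-identityˡ _) (sum-indicator-∉ xs (y∉xs ∘ there))

  sum-indicator-∈ : ∀ {xs : List I} {y r} → Unique xs → y ∈ xs →
                    sum xs (λ x → if does (y ≟ x) then r else 0#) ≈ r
  sum-indicator-∈ {xs = x ∷ xs} {y} (x∉xs ∷ uniq) y∈ with y ≟ x | y∈
  ... | yes ≡.refl | _          =
    trans (+-congˡ (sum-indicator-∉ xs λ y∈xs → All.lookup x∉xs y∈xs ≡.refl)) (+-identityʳ _)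
  ... | no y≢x     | here y≡x   = contradiction y≡x y≢x
  ... | no _       | there y∈xs = trans (+-identityˡ _) (sum-indicator-∈ uniq y∈xs)

  sum-indicator-≤ : ∀ {xs : List I} {y r} → Unique xs → 0# ≤ r →
                    sum xs (λ x → if does (y ≟ x) then r else 0#) ≤ r
  sum-indicator-≤ {xs = xs} {y} uniq 0≤r with em {P = y ∈ xs}
  ... | yes y∈xs = ≤-reflexive (sum-indicator-∈ uniq y∈xs)
  ... | no y∉xs  = ≤-respˡ (sym (sum-indicator-∉ xs y∉xs)) 0≤r

  -- Arbitrary sums

  -- The supremum is a maximum: `xs` is itself one of the admissible lists, and by `sum-⊆` no other
  -- one has a larger sum. The empty list shows that the family is inhabited.
  ∑-finite : ∀ {P : Pred I p} {f xs} → (∀ {x} → P x → 0# ≤ f x) →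
             Unique xs → All P xs → (∀ {x} → P x → 0# < f x → x ∈ xs) →
             ∑ P f ≈ sum xs f
  ∑-finite {xs = xs} f≥0 uniq all covers =
    isSup-unique (sup-isSup _ ([] , [] , []) (_ , upper)) (upper , λ b ub → ub (xs , uniq , all))
    where
    upper : UpperBound _ (sum xs _)
    upper (ys , uniq-ys , all-ys) =
      sum-⊆ uniq-ys (f≥0 ∘ All.lookup all-ys) (f≥0 ∘ All.lookup all)
            (covers ∘ All.lookup all-ys)

  ∑-⊑ : ∀ {P : Pred I p} {Q : Pred J q} {f g} (h : I → J) →
        (∀ {x y} → h x ≡ h y → x ≡ y) → (∀ {x} → P x → Q (h x)) → (∀ x → f x ≈ g (h x)) →
        _⊑_ {I = ∃ λ xs → Unique xs × All P xs} {J = ∃ λ ys → Unique ys × All Q ys}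
            (λ (xs , _) → sum xs f) (λ (ys , _) → sum ys g)
  ∑-⊑ h inj P⇒Q f≈g (xs , uniq , all) =
    (map h xs , Unique.map⁺ inj uniq , All.map⁺ (All.map P⇒Q all)) ,
    trans (sum-cong xs λ {x} _ → f≈g x) (sym (sum-map h xs))

  ∑-cong : ∀ {P : Pred I p} {Q : Pred I q} {f g} →
           (∀ {x} → P x → Q x) → (∀ {x} → Q x → P x) → (∀ x → f x ≈ g x) → ∑ P f ≈ ∑ Q g
  ∑-cong P⇒Q Q⇒P f≈g = sup-cong (∑-⊑ id id P⇒Q f≈g) (∑-⊑ id id Q⇒P (λ x → sym (f≈g x)))

  ∑-↔ : ∀ {f : I → ℝ} {g : J → ℝ} (e : I ↔ J) → (∀ x → f x ≈ g (to e x)) → ∑ U f ≈ ∑ U g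
  ∑-↔ {g = g} e f≈g = sup-cong
    (∑-⊑ (to e) (Injection.injective (↔⇒↣ e)) id f≈g)
    (∑-⊑ (from e) (Injection.injective (↔⇒↣ (↔-sym e))) id
      (λ y → trans (reflexive (≡.cong g (≡.sym (strictlyInverseˡ e y)))) (sym (f≈g (from e y)))))

  -- The list in `finiteSupport` may repeat entries and contain points of mass 0; removing both
  -- leaves an exact enumeration, over which the mass is an ordinary finite sum.
  support : ∀ {a} {X : Set a} (π : Dist X) →
            ∃ λ xs → Unique xs × (∀ {x} → x ∈ xs → x ∈supp π) ×
                     (∀ {x} → x ∈supp π → x ∈ xs) × sum xs (mass π) ≈ 1#
  support π = xs , uniq , sound , covers ,
    trans (sym (∑-finite (λ {x} _ → nonNeg x) uniq (All.universal-U _) (λ _ → covers))) total-mass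
    where
    open Dist π using (nonNeg; finiteSupport; total-mass)
    supp? : Decidable (_∈supp π)
    supp? _ = em

    candidates = deduplicate _≟_ (proj₁ finiteSupport)
    xs         = filter supp? candidates

    uniq : Unique xs
    uniq = Unique.filter⁺ supp? (UniqueDec.deduplicate-! _≟_ (proj₁ finiteSupport))

    sound : ∀ {x} → x ∈ xs → x ∈supp π
    sound x∈xs = proj₂ (∈-filter⁻ supp? {xs = candidates} x∈xs)

    covers : ∀ {x} → x ∈supp π → x ∈ xs
    covers x∈supp = ∈-filter⁺ supp? (∈-deduplicate⁺ _≟_ (proj₂ finiteSupport _ x∈supp)) x∈supp

  -- Kantorovich and Hausdorff liftings

  Cost : {X : Set i} {μ ν : X → ℝ} → (X → X → ℝ) → Coupling μ ν → ℝ
  Cost {X = X} d ω = ∑ {I = X × X} U (λ (x , y) → mass (joint ω) (x , y) * d x y)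

  -- A coupling on `X` is pushed forward along `e` in both coordinates; reindexing the sums
  -- preserves marginals, total mass and cost.
  Cost-⊑ : ∀ {X : Set i} {Y : Set j} {d : X → X → ℝ} {d′ : Y → Y → ℝ} {μ ν μ′ ν′} (e : X ↔ Y) →
           (∀ y y′ → d (from e y) (from e y′) ≈ d′ y y′) →
           (∀ y → μ (from e y) ≈ μ′ y) → (∀ y → ν (from e y) ≈ ν′ y) →
           Cost {μ = μ} {ν} d ⊑ Cost {μ = μ′} {ν′} d′
  Cost-⊑ {X = X} {Y} e d≈d′ μ≈μ′ ν≈ν′ ω = ω′ , sym (∑-↔ e²⁻¹ λ (y , y′) → *-congˡ (sym (d≈d′ y y′)))
    where
    open Coupling ω using (marginal₁; marginal₂)
    open Dist (joint ω) using (nonNeg; finiteSupport; total-mass)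

    e² : (X × X) ↔ (Y × Y)
    e² = e ×-↔ e

    e⁻¹ : Y ↔ X
    e⁻¹ = ↔-sym e

    e²⁻¹ : (Y × Y) ↔ (X × X)
    e²⁻¹ = ↔-sym e²

    ω′ : Coupling _ _
    ω′ = record
      { joint     = record
        { mass          = mass (joint ω) ∘ from e²
        ; nonNeg        = nonNeg ∘ from e²
        ; finiteSupport = map (to e²) (proj₁ finiteSupport) , λ y 0<m →
            ≡.subst (_∈ _) (strictlyInverseˡ e² y)
              (∈-map⁺ (to e²) (proj₂ finiteSupport (from e² y) 0<m))
        ; total-mass    = trans (∑-↔ e²⁻¹ λ _ → refl) total-mass
        }
      ; marginal₁ = λ y → trans (∑-↔ e⁻¹ λ _ → refl) (trans (marginal₁ (from e y)) (μ≈μ′ y))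
      ; marginal₂ = λ y → trans (∑-↔ e⁻¹ λ _ → refl) (trans (marginal₂ (from e y)) (ν≈ν′ y))
      }

  𝒦-↔ : ∀ {X : Set i} {Y : Set j} {d : X → X → ℝ} {d′ : Y → Y → ℝ} {μ ν μ′ ν′} (e : X ↔ Y) →
        (∀ x x′ → d x x′ ≈ d′ (to e x) (to e x′)) →
        (∀ x → μ x ≈ μ′ (to e x)) → (∀ x → ν x ≈ ν′ (to e x)) →
        𝒦 d μ ν ≈ 𝒦 d′ μ′ ν′
  𝒦-↔ {Y = Y} {d = d} {d′} {μ} {ν} {μ′} {ν′} e d≈d′ μ≈μ′ ν≈ν′ = inf-cong
    (Cost-⊑ e
      (λ y y′ → trans (d≈d′ _ _) (reflexive (≡.cong₂ d′ (strictlyInverseˡ e y) (strictlyInverseˡ e y′))))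
      (inverted μ μ′ μ≈μ′) (inverted ν ν′ ν≈ν′))
    (Cost-⊑ (↔-sym e) (λ x x′ → sym (d≈d′ x x′)) (sym ∘ μ≈μ′) (sym ∘ ν≈ν′))
    where
    inverted : ∀ ρ ρ′ → (∀ x → ρ x ≈ ρ′ (to e x)) → ∀ y → ρ (from e y) ≈ ρ′ y
    inverted _ ρ′ ρ≈ρ′ y = trans (ρ≈ρ′ _) (reflexive (≡.cong ρ′ (strictlyInverseˡ e y)))

  -- States that `R` is total in both directions. `forth` and `back` need not be mutually inverse:
  -- Hausdorff distances see only the values taken by the ground distance.
  record Correspondence {X : Set i} {X′ : Set j} (P : Pred X p) (P′ : Pred X′ q)
                        (R : X → X′ → Set r) : Set (i ⊔ j ⊔ p ⊔ q ⊔ r) where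
    field
      forth : ∃ P → ∃ P′
      back  : ∃ P′ → ∃ P
      forth-related : ∀ x → R (proj₁ x) (proj₁ (forth x))
      back-related  : ∀ x′ → R (proj₁ (back x′)) (proj₁ x′)
  open Correspondence

  ⋁⋀-cong : ∀ {a b} {X : Set i} {X′ : Set j} {P : Pred X p} {Q : Pred X q}
              {P′ : Pred X′ a} {Q′ : Pred X′ b} {R : X → X′ → Set r}
              {d : X → X → ℝ} {d′ : X′ → X′ → ℝ} →
            Correspondence P P′ R → Correspondence Q Q′ R →
            (∀ {x y x′ y′} → R x x′ → R y y′ → d x y ≈ d′ x′ y′) →
            ⋁ {I = ∃ P} (λ (x , _) → ⋀ {I = ∃ Q} λ (y , _) → d x y) ≈
            ⋁ {I = ∃ P′} (λ (x′ , _) → ⋀ {I = ∃ Q′} λ (y′ , _) → d′ x′ y′)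
  ⋁⋀-cong {Q = Q} {Q′ = Q′} {R = R} {d} {d′} P~P′ Q~Q′ d≈d′ = ⋁-cong
    (λ x → forth P~P′ x , inner (forth-related P~P′ x))
    (λ x′ → back P~P′ x′ , sym (inner (back-related P~P′ x′)))
    where
    inner : ∀ {x x′} → R x x′ →
            ⋀ {I = ∃ Q} (λ (y , _) → d x y) ≈ ⋀ {I = ∃ Q′} (λ (y′ , _) → d′ x′ y′)
    inner x~x′ = ⋀-cong
      (λ y → forth Q~Q′ y , d≈d′ x~x′ (forth-related Q~Q′ y))
      (λ y′ → back Q~Q′ y′ , sym (d≈d′ x~x′ (back-related Q~Q′ y′)))

  ℋ-cong : ∀ {a b} {X : Set i} {X′ : Set j} {P : Pred X p} {Q : Pred X q}
             {P′ : Pred X′ a} {Q′ : Pred X′ b} {R : X → X′ → Set r}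
             {d : X → X → ℝ} {d′ : X′ → X′ → ℝ} →
           Correspondence P P′ R → Correspondence Q Q′ R →
           (∀ {x y x′ y′} → R x x′ → R y y′ → d x y ≈ d′ x′ y′) →
           ℋ d P Q ≈ ℋ d′ P′ Q′
  ℋ-cong P~P′ Q~Q′ d≈d′ = max-cong (⋁⋀-cong P~P′ Q~Q′ d≈d′) (⋁⋀-cong Q~Q′ P~P′ d≈d′)

  -- Maximal computations of a resolution

  module _ {a} {A : Set a} (P : PTS A) where
    open PTS P

    -- Successors count as smaller, so that accessibility means termination.
    _◁_ : State → State → Set a
    u ◁ v = ∃ λ b → ∃ λ π → (v ─[ b ]→ π) × (u ∈supp π)

    -- Classically, an inaccessible state has an inaccessible successor; iterating the choice from
    -- `u` would produce an infinite computation.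
    Finite⇒Acc : ∀ {u} → Finite u → Acc _◁_ u
    Finite⇒Acc {u} finite = decidable-stable em λ ¬acc →
      finite (proj₁ ∘ descent ¬acc , ≡.refl , λ n → proj₁ (proj₂ (descend (descent ¬acc n))))
      where
      Bad = ∃ λ v → ¬ Acc _◁_ v

      descend : ((v , _) : Bad) → ∃ λ w → w ◁ v × ¬ Acc _◁_ w
      descend (v , ¬acc) = decidable-stable em λ ¬∃ →
        ¬acc (acc λ {w} w◁v → decidable-stable em λ ¬acc-w → ¬∃ (w , w◁v , ¬acc-w))

      descent : ¬ Acc _◁_ u → ℕ → Bad
      descent ¬acc zero    = u , ¬acc
      descent ¬acc (suc n) = let w , _ , ¬acc-w = descend (descent ¬acc n) in w , ¬acc-w

    record MaximalComputations (u : State) : Set a where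
      field
        list     : List Computation
        unique   : Unique list
        sound    : ∀ {c} → c ∈ list → 𝒞max u c
        complete : ∀ {c} → 𝒞max u c → c ∈ list
        total-Pr : sum list Pr ≈ 1#
    open MaximalComputations public

    Pr-pos : ∀ {u} c → IsComputation u c → 0# < Pr c
    Pr-pos []      _                       = 0<1
    Pr-pos (_ ∷ c) (_ , 0<π , isComputation) = *-pos 0<π (Pr-pos c isComputation)

    stuck-computations : ∀ {u} → (∀ {b π} → ¬ u ─[ b ]→ π) → MaximalComputations u
    stuck-computations stuck = record
      { list     = [ [] ]
      ; unique   = [] ∷ []
      ; sound    = λ { (here ≡.refl) → _ , maximal }
      ; complete = complete′
      ; total-Pr = +-identityʳ 1#
      }
      where
      maximal : ∀ c → IsComputation _ c → c ≡ []
      maximal []      _          = ≡.refl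
      maximal (_ ∷ _) (step , _) = contradiction step stuck

      complete′ : ∀ {c} → 𝒞max _ c → c ∈ [ [] ]
      complete′ {c} (isComp , _) = here (maximal c isComp)

    -- A maximal computation is the unique step into some `v` in the support followed by a maximal
    -- one from `v`. The branch at `v` has total probability `mass π v` times 1, and these masses
    -- add up to 1.
    step-computations : ∀ {u b π} → u ─[ b ]→ π → (∀ {b′ π′} → u ─[ b′ ]→ π′ → b′ ≡ b × π′ ≡ π) →
                        (∀ {v} → v ∈supp π → MaximalComputations v) → MaximalComputations u
    step-computations {u} {b} {π} step only rec = record
      { list     = concatMap branch targets
      ; unique   = Unique.concat⁺ (All.map⁺ (All.universal unique-branch _))
                     (AllPairs.map⁺ (AllPairs.map disjoint (proj₁ (proj₂ (support π)))))
      ; sound    = sound′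
      ; complete = complete′
      ; total-Pr = begin
          sum (concatMap branch targets) Pr                ≈⟨ sum-concatMap branch targets ⟩
          sum targets (λ v → sum (branch v) Pr)            ≈⟨ sum-cong targets total-branch ⟩
          sum targets (mass π)                             ≈⟨ targets-total ⟩
          1#                                               ∎
      }
      where
      targets = proj₁ (support π)
      targets-sound = proj₁ (proj₂ (proj₂ (support π)))
      targets-covers = proj₁ (proj₂ (proj₂ (proj₂ (support π))))
      targets-total = proj₂ (proj₂ (proj₂ (proj₂ (support π))))

      -- `concatMap` needs a function on all states, whereas `rec` applies only on the support; the
      -- value `[]` elsewhere never matters, since `targets` lies inside the support.
      rest : State → List Computation
      rest v with em {P = v ∈supp π}
      ... | yes v∈π = list (rec v∈π)
      ... | no _    = []

      branch : State → List Computation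
      branch v = map ((b , π , v) ∷_) (rest v)

      unique-rest : ∀ v → Unique (rest v)
      unique-rest v with em {P = v ∈supp π}
      ... | yes v∈π = unique (rec v∈π)
      ... | no _    = []

      unique-branch : ∀ v → Unique (branch v)
      unique-branch v = Unique.map⁺ (λ { ≡.refl → ≡.refl }) (unique-rest v)

      disjoint : ∀ {v w} → v ≢ w → ∀ {c} → ¬ (c ∈ branch v × c ∈ branch w)
      disjoint v≢w (c∈v , c∈w) with ∈-map⁻ _ c∈v | ∈-map⁻ _ c∈w
      ... | _ , _ , ≡.refl | _ , _ , ≡.refl = v≢w ≡.refl

      sound-rest : ∀ {v c} → c ∈ rest v → 𝒞max v c
      sound-rest {v} c∈ with em {P = v ∈supp π}
      ... | yes v∈π = sound (rec v∈π) c∈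

      complete-rest : ∀ {v c} → v ∈supp π → 𝒞max v c → c ∈ rest v
      complete-rest {v} v∈π max-c with em {P = v ∈supp π}
      ... | yes v∈π′ = complete (rec v∈π′) max-c
      ... | no v∉π   = contradiction v∈π v∉π

      total-rest : ∀ {v} → v ∈supp π → sum (rest v) Pr ≈ 1#
      total-rest {v} v∈π with em {P = v ∈supp π}
      ... | yes v∈π′ = total-Pr (rec v∈π′)
      ... | no v∉π   = contradiction v∈π v∉π

      total-branch : ∀ {v} → v ∈ targets → sum (branch v) Pr ≈ mass π v
      total-branch {v} v∈ = begin
        sum (branch v) Pr                       ≈⟨ sum-map _ (rest v) ⟩
        sum (rest v) (λ c → mass π v * Pr c)    ≈⟨ sum-*ˡ (mass π v) (rest v) ⟩
        mass π v * sum (rest v) Pr              ≈⟨ *-congˡ (total-rest (targets-sound v∈)) ⟩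
        mass π v * 1#                           ≈⟨ *-identityʳ _ ⟩
        mass π v                                ∎

      sound′ : ∀ {c} → c ∈ concatMap branch targets → 𝒞max u c
      sound′ c∈ with v , v∈ , c∈v ← find (∈-concatMap⁻ branch {xs = targets} c∈)
                with c , c∈rest , ≡.refl ← ∈-map⁻ _ c∈v =
        let isComp , maximal = sound-rest c∈rest
        in (step , targets-sound v∈ , isComp) , λ e (_ , _ , isComp′) → maximal e isComp′

      -- Without a support point the total mass would be 0 instead of 1.
      nonempty : ∃ (_∈supp π)
      nonempty = decidable-stable em λ ¬∃ → 0≉1 (trans (sym (empty-sum ¬∃)) targets-total)
        where
        empty-sum : ¬ ∃ (_∈supp π) → sum targets (mass π) ≈ 0#
        empty-sum ¬∃ = trans
          (sum-cong targets λ {v} v∈ → contradiction (v , targets-sound v∈) ¬∃) (sum-0 targets)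

      complete′ : ∀ {c} → 𝒞max u c → c ∈ concatMap branch targets
      -- The empty computation extends by a step into a support point, so it is not maximal.
      complete′ {[]} (_ , maximal) =
        let v , v∈π = nonempty in contradiction (maximal [ b , π , v ] (step , v∈π , _)) λ ()
      complete′ {(b′ , π′ , v) ∷ c} ((step′ , v∈π , isComp) , maximal) with ≡.refl , ≡.refl ← only step′ =
        ∈-concatMap⁺ branch (lose (targets-covers v∈π)
          (∈-map⁺ _ (complete-rest v∈π (isComp , λ e isComp′ → maximal e (step , v∈π , isComp′)))))

  -- Well-founded recursion on `corr z` in the process: matching transitions give `v` and `corr v`
  -- the same mass, so each step of the resolution maps to a step of the process and termination is
  -- inherited.
  resolution-computations : ∀ {a} {A : Set a} {P : PTS A} {s 𝒵} → (∀ u → PTS.Finite P u) → res P s 𝒵 →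
                            MaximalComputations (RootedPTS.pts 𝒵) (RootedPTS.root 𝒵)
  resolution-computations {P = P} {𝒵 = 𝒵} finite resolution = go root (Finite⇒Acc P (finite _))
    where
    open RootedPTS 𝒵
    open IsResolution resolution

    go : ∀ z → Acc (_◁_ P) (corr z) → MaximalComputations pts z
    go z (acc rec) with em {P = ∃ λ b → ∃ λ π → z ─[ b ]→ π}
    ... | no stuck = stuck-computations pts λ step → stuck (_ , _ , step)
    ... | yes (b , π , step) = step-computations pts step (λ step′ → deterministic step′ step) λ {v} v∈π →
      let π′ , step′ , π≈π′ = matched step
      in go v (rec (b , π′ , step′ , <-respʳ (π≈π′ v) v∈π))

  -- Trace distributions

  module _ {a} {A : Set a} (𝒵 : RootedPTS A)
           (computations : MaximalComputations (RootedPTS.pts 𝒵) (RootedPTS.root 𝒵)) where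
    open RootedPTS 𝒵
    private
      cs = list computations

      traced : List (A ∪τ) → List Computation
      traced α = filter (λ c → tr c ≟ α) cs

      Pr-nonNeg : ∀ {c} → 𝒞max root c → 0# ≤ Pr c
      Pr-nonNeg {c} (isComp , _) = proj₁ (Pr-pos pts c isComp)

      traced-sound : ∀ α {c} → c ∈ traced α → 𝒞max root c × tr c ≡ α
      traced-sound α c∈ =
        let c∈cs , tr≡α = ∈-filter⁻ (λ c → tr c ≟ α) {xs = cs} c∈
        in sound computations c∈cs , tr≡α

      TD-traced : ∀ α → TD 𝒵 α ≈ sum (traced α) Pr
      TD-traced α = ∑-finite (λ (max-c , _) → Pr-nonNeg max-c)
        (Unique.filter⁺ _ (unique computations)) (All.tabulate (traced-sound α))
        (λ (max-c , tr≡α) _ → ∈-filter⁺ (λ c → tr c ≟ α) (complete computations max-c) tr≡α)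

      -- Double counting: after the swap, each computation contributes its probability once for
      -- every entry of `αs` equal to its trace.
      sum-TD : ∀ αs → sum αs (TD 𝒵) ≈
               sum cs (λ c → sum αs λ α → if does (tr c ≟ α) then Pr c else 0#)
      sum-TD αs = trans
        (sum-cong αs λ {α} _ → trans (TD-traced α) (sum-filter (λ c → tr c ≟ α) cs))
        (sum-swap αs cs)

    TD-nonNeg : ∀ α → 0# ≤ TD 𝒵 α
    TD-nonNeg α = ≤-respʳ (sym (TD-traced α))
      (sum-nonNeg (traced α) λ c∈ → Pr-nonNeg (proj₁ (traced-sound α c∈)))

    TD-pos : ∀ {c} → 𝒞max root c → 0# < TD 𝒵 (tr c)
    TD-pos {c} max-c = <-respʳ (sym (TD-traced (tr c)))
      (<-≤-trans (<-respʳ (sym (+-identityʳ _)) (Pr-pos pts c (proj₁ max-c)))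
        (sum-⊆ {xs = [ c ]} ([] ∷ []) (λ { (here ≡.refl) → Pr-nonNeg max-c })
          (λ c∈ → Pr-nonNeg (proj₁ (traced-sound (tr c) c∈)))
          (λ { (here ≡.refl) _ → ∈-filter⁺ (λ c′ → tr c′ ≟ tr c) (complete computations max-c) ≡.refl })))

    sum-TD-≤1 : ∀ {αs} → Unique αs → sum αs (TD 𝒵) ≤ 1#
    -- As `αs` has no repetitions, each computation is counted at most once.
    sum-TD-≤1 {αs} uniq = ≤-respˡ (sym (sum-TD αs)) (≤-respʳ (total-Pr computations)
      (sum-mono-≤ cs λ c∈ → sum-indicator-≤ uniq (Pr-nonNeg (sound computations c∈))))

    sum-TD-≈1 : ∀ {αs} → Unique αs → (∀ {c} → 𝒞max root c → tr c ∈ αs) → sum αs (TD 𝒵) ≈ 1#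
    sum-TD-≈1 {αs} uniq covers = trans (sum-TD αs) (trans
      (sum-cong cs λ c∈ → sum-indicator-∈ uniq (covers (sound computations c∈)))
      (total-Pr computations))

  -- Trace distribution formulae

  module _ {a} {A : Set a} where

    formulaOf : List (A ∪τ) → TraceFormula A
    formulaOf []      = tt
    formulaOf (b ∷ α) = ⟨ b ⟩ formulaOf α

    word-formulaOf : ∀ α → word (formulaOf α) ≡ α
    word-formulaOf []      = ≡.refl
    word-formulaOf (b ∷ α) = ≡.cong (b ∷_) (word-formulaOf α)

    formulaOf-word : ∀ (Φ : TraceFormula A) → formulaOf (word Φ) ≡ Φ
    formulaOf-word tt        = ≡.refl
    formulaOf-word (⟨ b ⟩ Φ) = ≡.cong (⟨ b ⟩_) (formulaOf-word Φ)

    word-↔ : TraceFormula A ↔ List (A ∪τ)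
    word-↔ = mk↔ₛ′ word formulaOf word-formulaOf formulaOf-word

    word-injective : ∀ {Φ Ψ : TraceFormula A} → word Φ ≡ word Ψ → Φ ≡ Ψ
    word-injective = Injection.injective (↔⇒↣ word-↔)

    module _ (𝒵 : RootedPTS A) where
      open RootedPTS 𝒵

      -- Satisfaction alone makes `word Φ` only a prefix of the trace; equal length rules out a
      -- proper one.
      ⊨ᶜ⇒tr : ∀ c (Φ : TraceFormula A) → _⊨ᶜ_ 𝒵 c Φ → length c ≡ depth Φ → tr c ≡ word Φ
      ⊨ᶜ⇒tr []      tt        _              _   = ≡.refl
      ⊨ᶜ⇒tr (_ ∷ c) (⟨ b ⟩ Φ) (≡.refl , c⊨Φ) len = ≡.cong (b ∷_) (⊨ᶜ⇒tr c Φ c⊨Φ (suc-injective len))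

      tr⇒⊨ᶜ : ∀ c (Φ : TraceFormula A) → tr c ≡ word Φ → _⊨ᶜ_ 𝒵 c Φ × length c ≡ depth Φ
      tr⇒⊨ᶜ []      tt        _  = _ , ≡.refl
      tr⇒⊨ᶜ (_ ∷ c) (⟨ b ⟩ Φ) eq =
        let c⊨Φ , len = tr⇒⊨ᶜ c Φ (∷-injectiveʳ eq) in (∷-injectiveˡ eq , c⊨Φ) , ≡.cong suc len

      TD-⊨ᶜ : ∀ Φ → TD 𝒵 (word Φ) ≈ ∑ (λ c → 𝒞max root c × _⊨ᶜ_ 𝒵 c Φ × length c ≡ depth Φ) Pr
      TD-⊨ᶜ Φ = ∑-cong
        (λ {c} (max-c , tr≡) → max-c , tr⇒⊨ᶜ c Φ tr≡)
        (λ {c} (max-c , c⊨Φ , len) → max-c , ⊨ᶜ⇒tr c Φ c⊨Φ len)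
        (λ _ → refl)

    -- Unlike `Realises`, this also constrains the words that are absent from the formula, as a
    -- comparison of couplings requires.
    Represents : RootedPTS A → TraceDistFormula A → Set a
    Represents 𝒵 Ψ = ∀ Φ → TD 𝒵 (word Φ) ≈ TraceDistFormula.⟦_⟧ Ψ Φ

    Realises⇒Represents : ∀ {𝒵} Ψ → MaximalComputations (RootedPTS.pts 𝒵) (RootedPTS.root 𝒵) →
                          Realises 𝒵 Ψ → Represents 𝒵 Ψ
    Realises⇒Represents {𝒵} Ψ computations realises Φ with em {P = ∃ λ k → TraceDistFormula.formula Ψ k ≡ Φ}
    ... | yes (k , ≡.refl) = begin
        TD 𝒵 (word (formula k))   ≈⟨ TD-⊨ᶜ 𝒵 (formula k) ⟩
        _                         ≈⟨ realises k ⟩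
        -- The formulae are pairwise distinct, so `k` is the only index contributing to
        -- `⟦ formula k ⟧`.
        weight k                  ≈⟨ +-identityʳ _ ⟨
        sum [ k ] weight          ≈⟨ ∑-finite (λ {l} _ → proj₁ (weight-pos l)) ([] ∷ []) (≡.refl ∷ [])
                                       (λ eq _ → here (distinct eq)) ⟨
        ⟦ formula k ⟧             ∎
      where open TraceDistFormula Ψ
    ... | no ∄k = begin
        TD 𝒵 (word Φ)   ≈⟨ antisym TD-≤0 (TD-nonNeg 𝒵 computations (word Φ)) ⟩
        0#              ≈⟨ ∑-finite (λ {l} _ → proj₁ (weight-pos l)) [] []
                             (λ eq _ → contradiction (_ , eq) ∄k) ⟨
        ⟦ Φ ⟧           ∎
      where
      open TraceDistFormula Ψ

      words : List (List (A ∪τ))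
      words = map (word ∘ formula) (allFin _)

      unique-words : Unique (word Φ ∷ words)
      unique-words =
        All.map⁺ (All.universal (λ k eq → ∄k (k , word-injective (≡.sym eq))) _) ∷
        Unique.map⁺ (distinct ∘ word-injective) (Unique.allFin⁺ _)

      sum-words : sum words (TD 𝒵) ≈ 1#
      sum-words = begin
        sum words (TD 𝒵)                            ≈⟨ sum-map (word ∘ formula) (allFin _) ⟩
        sum (allFin _) (TD 𝒵 ∘ word ∘ formula)      ≈⟨ sum-cong (allFin _) (λ {k} _ →
                                                         trans (TD-⊨ᶜ 𝒵 (formula k)) (realises k)) ⟩
        sum (allFin _) weight                       ≈⟨ ∑-finite (λ {l} _ → proj₁ (weight-pos l)) (Unique.allFin⁺ _)
                                                         (All.universal-U _) (λ {k} _ _ → ∈-allFin k) ⟨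
        ∑ U weight                                  ≈⟨ weight-sum ⟩
        1#                                          ∎

      TD-≤0 : TD 𝒵 (word Φ) ≤ 0#
      -- The words of the formula already carry mass 1, so adjoining the fresh `word Φ` can add
      -- nothing without exceeding 1.
      TD-≤0 = +-cancelʳ-≤ 1# (≤-respˡ (+-congˡ sum-words)
        (≤-respʳ (sym (+-identityˡ 1#)) (sum-TD-≤1 𝒵 computations unique-words)))

    traceFormula : ∀ {𝒵} → MaximalComputations (RootedPTS.pts 𝒵) (RootedPTS.root 𝒵) →
                   ∃ (Realises 𝒵)
    traceFormula {𝒵} computations =
      fromTraces (deduplicate _≟_ traces) (UniqueDec.deduplicate-! _≟_ traces)
        (λ α∈ → let c , c∈ , α≡tr = ∈-map⁻ tr (∈-deduplicate⁻ _≟_ traces α∈)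
                in c , sound computations c∈ , ≡.sym α≡tr)
        (λ max-c → ∈-deduplicate⁺ _≟_ (∈-map⁺ tr (complete computations max-c)))
      where
      open RootedPTS 𝒵

      traces : List (List (A ∪τ))
      traces = map tr (list computations)

      -- Abstracts over the list of traces so that it can be split by cases: a formula has a
      -- nonempty index set `Fin (suc _)`, and an empty list would give total mass 0.
      fromTraces : ∀ αs → Unique αs → (∀ {α} → α ∈ αs → ∃ λ c → 𝒞max root c × tr c ≡ α) →
                   (∀ {c} → 𝒞max root c → tr c ∈ αs) → ∃ (Realises 𝒵)
      fromTraces []           uniq attained covers =
        contradiction (sum-TD-≈1 𝒵 computations uniq covers) 0≉1
      fromTraces αs@(_ ∷ _) uniq attained covers = Ψ , λ k →
        trans (sym (TD-⊨ᶜ 𝒵 (formulaOf (lookup αs k))))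
              (reflexive (≡.cong (TD 𝒵) (word-formulaOf (lookup αs k))))
        where
        weight : Fin (length αs) → ℝ
        weight k = TD 𝒵 (lookup αs k)

        weight-sum : ∑ U weight ≈ 1#
        weight-sum = begin
          ∑ U weight                            ≈⟨ ∑-finite (λ _ → TD-nonNeg 𝒵 computations _) (Unique.allFin⁺ _)
                                                     (All.universal-U _) (λ {k} _ _ → ∈-allFin k) ⟩
          sum (allFin _) weight                 ≈⟨ sum-map (lookup αs) (allFin _) ⟨
          sum (map (lookup αs) (allFin _)) (TD 𝒵) ≡⟨ ≡.cong (λ βs → sum βs (TD 𝒵))
                                                     (≡.trans (map-tabulate id (lookup αs)) (tabulate-lookup αs)) ⟩
          sum αs (TD 𝒵)                         ≈⟨ sum-TD-≈1 𝒵 computations uniq covers ⟩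
          1#                                    ∎

        weight-pos : ∀ k → 0# < weight k
        weight-pos k with c , max-c , tr≡ ← attained (∈-lookup k) =
          ≡.subst (λ α → 0# < TD 𝒵 α) tr≡ (TD-pos 𝒵 computations max-c)

        Ψ : TraceDistFormula A
        Ψ = record
          { weight     = weight
          ; formula    = formulaOf ∘ lookup αs
          ; distinct   = λ eq → lookup-injective uniq _ _
                           (Injection.injective (↔⇒↣ (↔-sym word-↔)) eq)
          ; weight-pos = weight-pos
          -- A single weight is the sum over a one-element list of traces.
          ; weight-≤1  = λ k → ≤-respˡ (+-identityʳ _)
                           (sum-TD-≤1 𝒵 computations {[ lookup αs k ]} ([] ∷ []))
          ; weight-sum = weight-sum
          }

    -- By definition `d-wL` is `d-w` composed with `word`, so the ground costs agree by `refl` along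
    -- the bijection `word-↔`.
    D-w≈D-wL : ∀ {𝒵₁ 𝒵₂} Ψ₁ Ψ₂ → Represents 𝒵₁ Ψ₁ → Represents 𝒵₂ Ψ₂ → D-w 𝒵₁ 𝒵₂ ≈ D-wL Ψ₁ Ψ₂
    D-w≈D-wL _ _ 𝒵₁~Ψ₁ 𝒵₂~Ψ₂ = sym (𝒦-↔ word-↔ (λ _ _ → refl) (sym ∘ 𝒵₁~Ψ₁) (sym ∘ 𝒵₂~Ψ₂))

    res~ℒ-w : ∀ (P : PTS A) → (∀ u → PTS.Finite P u) → ∀ s →
              Correspondence (res P s) (ℒ-w P s) Represents
    res~ℒ-w P finite s = record
      { forth         = λ (𝒵 , resolution) →
          let Ψ , realises = traceFormula (resolution-computations finite resolution)
          in Ψ , 𝒵 , resolution , realises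
      -- Satisfaction of a formula already carries a resolution that realises it.
      ; back          = λ (_ , 𝒵 , resolution , _) → 𝒵 , resolution
      ; forth-related = λ (_ , resolution) →
          let computations = resolution-computations finite resolution
              Ψ , realises = traceFormula computations
          in Realises⇒Represents Ψ computations realises
      ; back-related  = λ (Ψ , _ , resolution , realises) →
          Realises⇒Represents Ψ (resolution-computations finite resolution) realises
      }

theorem18 : (em : ∀ {ℓ} → ExcludedMiddle ℓ) (reals : Reals) →
    let open Reals reals using (_≈_)
        open TraceMetrics em reals in
    ∀ {ℓ} (A : Set ℓ) (P : PTS A) →
    let open PTS P in
    (∀ u → ImageFinite u) → (∀ u → Finite u) →
    (s t : State) → 𝐝-w P s t ≈ D-ℒw P s t
theorem18 em reals A P _ finite s t =
  ℋ-cong (res~ℒ-w P finite s) (res~ℒ-w P finite t) λ {_} {_} {Ψ₁} {Ψ₂} → D-w≈D-wL Ψ₁ Ψ₂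
  where open Proof em reals
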